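{- Let $k\ge 3$ and $n\ge 1$. Consider the puzzle with $k$ pegs and $n$ disks of arbitrary pairwise distinct sizes (not necessarily consecutive sizes), all initially on the Source peg, and let $P$ be any other peg. In any sequence of legal moves that transfers all $n$ disks from the Source to $P$ and has the minimum possible length, the number of moves made before the biggest disk is moved (i.e. before its first move) is equal to the number of moves made after the biggest disk is moved (i.e. after its last move).
   Context: The $k$-peg Tower of Hanoi with $n$ disks: there are $k$ pegs and $n$ disks of pairwise distinct sizes. Initially all disks are on one peg (the Source), stacked in decreasing size from bottom to top. A legal move takes the top disk of one peg and places it on top of the stack on another peg, provided that this other peg is empty or its top disk is larger than the moved disk. -}

module Defs where

open import Data.Fin using (Fin; _≟_)
open import Data.List using (List; []; _∷_; length; reverse; takeWhile)
open import Data.List.Membership.Propositional using (_∈_)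
open import Data.List.Relation.Unary.Linked using (Linked)
open import Data.Nat using (ℕ; _≤_)
open import Data.Product using (_×_)
open import Data.Vec using (Vec; lookup; _[_]≔_)
open import Relation.Binary.Bundles using (StrictTotalOrder)
open import Relation.Binary.Construct.Closure.ReflexiveTransitive using (Star; ε; _◅_)
open import Relation.Binary.PropositionalEquality using (_≡_; _≢_)
open import Relation.Nullary.Decidable using (¬?)

-- Sizes are taken in an arbitrary strict total order: only comparisons
-- between sizes matter for the puzzle.
module Hanoi {c ℓ₁ ℓ₂} (O : StrictTotalOrder c ℓ₁ ℓ₂) (k n : ℕ)
             (size : Fin n → StrictTotalOrder.Carrier O) where

  open StrictTotalOrder O using (_<_)

  Peg Disk Stack State : Set
  Peg   = Fin k
  Disk  = Fin n
  -- The head of the list is the top of the stack.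
  Stack = List Disk
  State = Vec Stack k

  _≺_ : Disk → Disk → Set ℓ₂
  d ≺ e = size d < size e

  data CanPlace (d : Disk) : Stack → Set ℓ₂ where
    on-empty  : CanPlace d []
    on-larger : ∀ {e es} → d ≺ e → CanPlace d (e ∷ es)

  record Move (s t : State) : Set ℓ₂ where
    field
      from to  : Peg
      disk     : Disk
      rest     : Stack
      from≢to  : from ≢ to
      top      : lookup s from ≡ disk ∷ rest
      canPlace : CanPlace disk (lookup s to)
      result   : t ≡ (s [ from ]≔ rest) [ to ]≔ (disk ∷ lookup s to)

  Moves : State → State → Set ℓ₂
  Moves = Star Move

  movedDisks : ∀ {s t} → Moves s t → List Disk
  movedDisks ε        = []
  movedDisks (m ◅ ms) = Move.disk m ∷ movedDisks ms

  numMoves : ∀ {s t} → Moves s t → ℕ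
  numMoves ms = length (movedDisks ms)

  -- Linked _≺_ forces each disk to occur at most once.
  IsTower : Peg → State → Set ℓ₂
  IsTower p s = (∀ d → d ∈ lookup s p)
              × Linked _≺_ (lookup s p)
              × (∀ q → q ≢ p → lookup s q ≡ [])

  IsBiggest : Disk → Set ℓ₂
  IsBiggest b = ∀ d → d ≢ b → d ≺ b

  -- Shortest among all transfers from s to a tower on p.
  IsOptimal : ∀ {s t} → Peg → Moves s t → Set ℓ₂
  IsOptimal {s} p ms =
    ∀ {t′} → IsTower p t′ → (ms′ : Moves s t′) → numMoves ms ≤ numMoves ms′

  -- Both counts equal the total number of moves if b is never moved; this
  -- cannot happen in a transfer of all the disks to a different peg.
  movesBeforeFirst movesAfterLast : ∀ {s t} → Disk → Moves s t → ℕ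
  movesBeforeFirst b ms = length (takeWhile (λ d → ¬? (d ≟ b)) (movedDisks ms))
  movesAfterLast   b ms = length (takeWhile (λ d → ¬? (d ≟ b)) (reverse (movedDisks ms)))

{-# OPTIONS --safe #-}
-- Let a and c be the numbers of moves before the first and after the last move
-- of the biggest disk. When the biggest disk moves, its peg holds nothing else
-- and the target peg is empty, so the effect is to exchange these two pegs.
-- Replaying the first a moves backwards with the two pegs exchanged therefore
-- completes a transfer of the whole tower in 2a + 1 moves. By optimality
-- a + 1 + c ≤ 2a + 1, that is c ≤ a. The reversed solution is optimal as well,
-- which gives a ≤ c.
module Submission where

open import Defs
open import Data.Fin using (Fin; _≟_)
open import Data.Fin.Permutation
  using (Permutation′; _⟨$⟩ˡ_; _⟨$⟩ʳ_; inverseˡ; inverseʳ; transpose)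
open import Data.List
  using (List; []; _∷_; _∷ʳ_; _++_; [_]; length; reverse; takeWhile)
open import Data.List.Membership.Propositional using (_∈_; _∉_)
open import Data.List.Membership.Propositional.Properties using (∈-∃++)
open import Data.List.Properties
  using (length-++; length-reverse; reverse-++; reverse-involutive; unfold-reverse; ++-assoc)
import Data.List.Relation.Unary.All as All
open import Data.List.Relation.Unary.AllPairs using (AllPairs; []; _∷_)
open import Data.List.Relation.Unary.Any using (here; there)
open import Data.List.Relation.Unary.Any.Properties using (reverse⁺; reverse⁻)
open import Data.List.Relation.Unary.Linked as Linked using (Linked; []; [-]; _∷_)
open import Data.List.Relation.Unary.Linked.Properties using (Linked⇒AllPairs)
open import Data.Nat using (ℕ; suc; _+_; _≤_; z≤n; s≤s; s≤s⁻¹)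
open import Data.Nat.Properties
  using (≤-trans; ≤-reflexive; ≤-antisym; +-mono-≤; +-comm; +-suc; +-cancelˡ-≤;
         module ≤-Reasoning)
open import Data.Product using (Σ; ∃; _×_; _,_; proj₂)
open import Data.Vec using (Vec; lookup; tabulate; _[_]≔_)
open import Data.Vec.Properties
  using (lookup∘tabulate; tabulate∘lookup; tabulate-cong; lookup∘update; lookup∘update′;
         []≔-idempotent; []≔-commutes; []≔-lookup)
open import Function using (_∘_)
open import Function.Definitions using (Injective)
open import Relation.Binary.Bundles using (StrictTotalOrder)
open import Relation.Binary.Construct.Closure.ReflexiveTransitive using (ε; _◅_; _◅◅_; gmap)
open import Relation.Binary.PropositionalEquality
  using (_≡_; _≢_; refl; sym; trans; cong; cong₂; subst; module ≡-Reasoning)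
open import Relation.Nullary using (¬_; yes; no; contradiction)
open import Relation.Nullary.Decidable using (¬?; dec-true)

-- Prefixes of a list before the first occurrence of an element.

module _ {n : ℕ} where

  prefixBefore : Fin n → List (Fin n) → List (Fin n)
  prefixBefore b = takeWhile (λ d → ¬? (d ≟ b))

  prefixBefore-∉ : ∀ {b} xs → b ∉ xs → prefixBefore b xs ≡ xs
  prefixBefore-∉         []       _    = refl
  prefixBefore-∉ {b = b} (x ∷ xs) b∉xs with x ≟ b
  ... | yes x≡b = contradiction (here (sym x≡b)) b∉xs
  ... | no  _   = cong (x ∷_) (prefixBefore-∉ xs (b∉xs ∘ there))

  -- Only an inequality, because `b` may already occur in `xs`.
  prefixBefore-≤ : ∀ b xs ys → length (prefixBefore b (xs ++ b ∷ ys)) ≤ length xs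
  prefixBefore-≤ b [] ys with b ≟ b
  ... | yes _   = z≤n
  ... | no  b≢b = contradiction refl b≢b
  prefixBefore-≤ b (x ∷ xs) ys with x ≟ b
  ... | yes _ = z≤n
  ... | no  _ = s≤s (prefixBefore-≤ b xs ys)

  -- Split the list at any occurrence of `b`: the initial prefix ends no later than this occurrence,
  -- and the prefix of the reversed list lies after it. The `suc` pays for the occurrence itself.
  -- The inequality can be strict, since the biggest disk may move several times.
  prefixes-≤ : ∀ {b xs} → b ∈ xs →
    length (prefixBefore b xs) + suc (length (prefixBefore b (reverse xs))) ≤ length xs
  prefixes-≤ {b} b∈xs with ∈-∃++ b∈xs
  ... | ys , zs , refl = begin
    length (prefixBefore b (ys ++ b ∷ zs)) + suc (length (prefixBefore b (reverse (ys ++ b ∷ zs))))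
      ≤⟨ +-mono-≤ (prefixBefore-≤ b ys zs) (s≤s suffix-≤) ⟩
    length ys + length (b ∷ zs)
      ≡⟨ length-++ ys ⟨
    length (ys ++ b ∷ zs) ∎
    where
    open ≤-Reasoning
    reversed : reverse (ys ++ b ∷ zs) ≡ reverse zs ++ b ∷ reverse ys
    reversed = trans (reverse-++ ys (b ∷ zs))
      (trans (cong (_++ reverse ys) (unfold-reverse b zs)) (++-assoc (reverse zs) [ b ] (reverse ys)))
    suffix-≤ : length (prefixBefore b (reverse (ys ++ b ∷ zs))) ≤ length zs
    suffix-≤ rewrite reversed =
      ≤-trans (prefixBefore-≤ b (reverse zs) (reverse ys)) (≤-reflexive (length-reverse zs))

-- Permuting the entries of a vector, used to rename pegs.

module _ {a} {A : Set a} {n : ℕ} where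

  lookup-injective : {xs ys : Vec A n} → (∀ i → lookup xs i ≡ lookup ys i) → xs ≡ ys
  lookup-injective {xs} {ys} eq =
    trans (sym (tabulate∘lookup xs)) (trans (tabulate-cong eq) (tabulate∘lookup ys))

  -- Reading through the inverse makes the entry at `i` travel to `π ⟨$⟩ʳ i`.
  permute : Permutation′ n → Vec A n → Vec A n
  permute π xs = tabulate (λ i → lookup xs (π ⟨$⟩ˡ i))

  lookup-permute : ∀ π xs i → lookup (permute π xs) (π ⟨$⟩ʳ i) ≡ lookup xs i
  lookup-permute π xs i =
    trans (lookup∘tabulate _ (π ⟨$⟩ʳ i)) (cong (lookup xs) (inverseˡ π))

  permute-update : ∀ π xs i x → permute π (xs [ i ]≔ x) ≡ permute π xs [ π ⟨$⟩ʳ i ]≔ x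
  permute-update π xs i x = lookup-injective λ j → trans (lookup∘tabulate _ j) (pointwise j)
    where
    pointwise : ∀ j →
      lookup (xs [ i ]≔ x) (π ⟨$⟩ˡ j) ≡ lookup (permute π xs [ π ⟨$⟩ʳ i ]≔ x) j
    pointwise j with j ≟ π ⟨$⟩ʳ i
    ... | yes refl rewrite inverseˡ π {i} =
          trans (lookup∘update i xs x) (sym (lookup∘update (π ⟨$⟩ʳ i) (permute π xs) x))
    ... | no j≢πi = begin
          lookup (xs [ i ]≔ x) (π ⟨$⟩ˡ j)
            ≡⟨ lookup∘update′ (λ { refl → j≢πi (sym (inverseʳ π)) }) xs x ⟩
          lookup xs (π ⟨$⟩ˡ j)
            ≡⟨ lookup∘tabulate _ j ⟨
          lookup (permute π xs) j
            ≡⟨ lookup∘update′ j≢πi (permute π xs) x ⟨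
          lookup (permute π xs [ π ⟨$⟩ʳ i ]≔ x) j ∎
      where open ≡-Reasoning

  -- The right-hand side has the shape of `Move.result`, so that a move between otherwise empty pegs
  -- can be recognised as an exchange.
  permute-transpose : ∀ i j (xs : Vec A n) →
    permute (transpose i j) xs ≡ (xs [ i ]≔ lookup xs j) [ j ]≔ lookup xs i
  permute-transpose i j xs = lookup-injective λ l → trans (lookup∘tabulate _ l) (pointwise l)
    where
    pointwise : ∀ l → lookup xs (transpose i j ⟨$⟩ˡ l) ≡
                      lookup ((xs [ i ]≔ lookup xs j) [ j ]≔ lookup xs i) l
    pointwise l with l ≟ j
    ... | yes refl = sym (lookup∘update j (xs [ i ]≔ lookup xs j) (lookup xs i))
    ... | no l≢j with l ≟ i
    ...   | yes refl = sym (trans (lookup∘update′ l≢j (xs [ i ]≔ lookup xs j) (lookup xs i))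
                                  (lookup∘update i xs (lookup xs j)))
    ...   | no l≢i = sym (trans (lookup∘update′ l≢j (xs [ i ]≔ lookup xs j) (lookup xs i))
                                (lookup∘update′ l≢i xs (lookup xs j)))

  -- Meant for two pegs that are both empty in the initial state.
  permute-transpose-id : ∀ i j (xs : Vec A n) → lookup xs i ≡ lookup xs j →
    permute (transpose i j) xs ≡ xs
  permute-transpose-id i j xs eq = begin
    permute (transpose i j) xs
      ≡⟨ permute-transpose i j xs ⟩
    (xs [ i ]≔ lookup xs j) [ j ]≔ lookup xs i
      ≡⟨ cong₂ (λ x y → (xs [ i ]≔ x) [ j ]≔ y) (sym eq) eq ⟩
    (xs [ i ]≔ lookup xs i) [ j ]≔ lookup xs j
      ≡⟨ cong (_[ j ]≔ lookup xs j) ([]≔-lookup xs i) ⟩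
    xs [ j ]≔ lookup xs j
      ≡⟨ []≔-lookup xs j ⟩
    xs ∎
    where open ≡-Reasoning

transpose-ˡ : ∀ {n} (i j : Fin n) → transpose i j ⟨$⟩ʳ i ≡ j
transpose-ˡ i j rewrite dec-true (i ≟ i) refl = refl

module _ {c ℓ₁ ℓ₂} (O : StrictTotalOrder c ℓ₁ ℓ₂) (k n : ℕ)
         (size : Fin n → StrictTotalOrder.Carrier O) where

  open Hanoi O k n size
  open StrictTotalOrder O using (asym; irrefl; module Eq) renaming (trans to <-trans)
  open import Data.List.Membership.DecPropositional (_≟_ {n}) using (_∈?_)

  -- Sorted stacks and uniqueness of towers.

  ≺-irrefl : ∀ {d} → ¬ (d ≺ d)
  ≺-irrefl = irrefl Eq.refl

  -- The heads agree: otherwise each would lie in the tail of the other list and so be larger than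
  -- the other head. By irreflexivity a head does not recur in its own tail, so the inclusions pass
  -- to the tails.
  sorted-unique : ∀ {xs ys} → AllPairs _≺_ xs → AllPairs _≺_ ys →
    (∀ {d} → d ∈ xs → d ∈ ys) → (∀ {d} → d ∈ ys → d ∈ xs) → xs ≡ ys
  sorted-unique [] [] _ _ = refl
  sorted-unique [] (_ ∷ _) _ ys⊆xs with () ← ys⊆xs (here refl)
  sorted-unique (_ ∷ _) [] xs⊆ys _ with () ← xs⊆ys (here refl)
  sorted-unique {x ∷ xs} {y ∷ ys} (x≺ ∷ xs↗) (y≺ ∷ ys↗) xs⊆ys ys⊆xs =
    cong₂ _∷_ x≡y (sorted-unique xs↗ ys↗
      (λ d∈ → drop (λ { refl → ≺-irrefl (subst (_≺ y) x≡y (All.lookup x≺ d∈)) }) (xs⊆ys (there d∈)))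
      (λ d∈ → drop (λ { refl → ≺-irrefl (subst (y ≺_) x≡y (All.lookup y≺ d∈)) }) (ys⊆xs (there d∈))))
    where
    drop : ∀ {d z : Disk} {zs} → d ≢ z → d ∈ z ∷ zs → d ∈ zs
    drop d≢z (here d≡z)  = contradiction d≡z d≢z
    drop _   (there d∈zs) = d∈zs
    x≡y : x ≡ y
    x≡y with xs⊆ys (here refl) | ys⊆xs (here refl)
    ... | here x≡y   | _          = x≡y
    ... | there _    | here y≡x   = sym y≡x
    ... | there x∈ys | there y∈xs = contradiction (All.lookup x≺ y∈xs) (asym (All.lookup y≺ x∈ys))

  tower-unique : ∀ {p} s t → IsTower p s → IsTower p t → s ≡ t
  tower-unique {p} s t (s-all , s↗ , s-empty) (t-all , t↗ , t-empty) = lookup-injective same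
    where
    same : ∀ q → lookup s q ≡ lookup t q
    same q with q ≟ p
    ... | yes refl = sorted-unique (Linked⇒AllPairs <-trans s↗) (Linked⇒AllPairs <-trans t↗)
                       (λ {d} _ → t-all d) (λ {d} _ → s-all d)
    ... | no q≢p = trans (s-empty q q≢p) (sym (t-empty q q≢p))

  permute-tower : ∀ π {p} s → IsTower p s → IsTower (π ⟨$⟩ʳ p) (permute π s)
  permute-tower π {p} s (s-all , s↗ , s-empty) =
    (λ d → subst (d ∈_) (sym eq) (s-all d)) ,
    subst (Linked _≺_) (sym eq) s↗ ,
    λ q q≢πp → trans (lookup∘tabulate _ q)
                     (s-empty _ (λ { refl → q≢πp (sym (inverseʳ π)) }))
    where eq = lookup-permute π s p

  -- Legal states, and the effect, reversal and renaming of a single move.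

  Legal : State → Set ℓ₂
  Legal s = ∀ p → Linked _≺_ (lookup s p)

  tower-legal : ∀ {p} s → IsTower p s → Legal s
  tower-legal {p} s (_ , s↗ , s-empty) q with q ≟ p
  ... | yes refl = s↗
  ... | no q≢p rewrite s-empty q q≢p = []

  module _ {s t : State} (m : Move s t) where
    open Move m

    lookup-to : lookup t to ≡ disk ∷ lookup s to
    lookup-to = trans (cong (λ u → lookup u to) result) (lookup∘update to (s [ from ]≔ rest) _)

    lookup-from : lookup t from ≡ rest
    lookup-from = trans (cong (λ u → lookup u from) result)
      (trans (lookup∘update′ from≢to (s [ from ]≔ rest) _) (lookup∘update from s rest))

    lookup-other : ∀ {p} → p ≢ from → p ≢ to → lookup t p ≡ lookup s p
    lookup-other {p} p≢from p≢to = trans (cong (λ u → lookup u p) result)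
      (trans (lookup∘update′ p≢to (s [ from ]≔ rest) _) (lookup∘update′ p≢from s rest))

    -- A move is one pop and one push, so a property stated peg by peg only has to survive these
    -- two. `Q` may depend on the peg, which `move-onlyOn` exploits.
    move-preserves : ∀ {ℓ} (Q : Peg → Stack → Set ℓ) →
      (Q from (disk ∷ rest) → Q from rest) →
      (Q to (lookup s to) → Q to (disk ∷ lookup s to)) →
      (∀ p → Q p (lookup s p)) → ∀ p → Q p (lookup t p)
    move-preserves Q pop push Qs p with p ≟ to
    ... | yes refl = subst (Q to) (sym lookup-to) (push (Qs to))
    ... | no p≢to with p ≟ from
    ...   | yes refl  = subst (Q from) (sym lookup-from) (pop (subst (Q from) top (Qs from)))
    ...   | no p≢from = subst (Q p) (sym (lookup-other p≢from p≢to)) (Qs p)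

    move-legal : Legal s → Legal t
    move-legal = move-preserves (λ _ → Linked _≺_) Linked.tail (push canPlace)
      where
      push : ∀ {d ds} → CanPlace d ds → Linked _≺_ ds → Linked _≺_ (d ∷ ds)
      push on-empty        _   = [-]
      push (on-larger d≺e) ds↗ = d≺e ∷ ds↗

    -- Legality of `s` says that the moved disk was smaller than the one beneath it, which is what
    -- permits putting it back.
    undo : Legal s → Move t s
    undo s-legal = record
      { from     = to
      ; to       = from
      ; disk     = disk
      ; rest     = lookup s to
      ; from≢to  = from≢to ∘ sym
      ; top      = lookup-to
      ; canPlace = subst (CanPlace disk) (sym lookup-from)
                     (placeable (subst (Linked _≺_) top (s-legal from)))
      ; result   = restored
      }
      where
      placeable : ∀ {d ds} → Linked _≺_ (d ∷ ds) → CanPlace d ds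
      placeable [-]       = on-empty
      placeable (d≺e ∷ _) = on-larger d≺e
      open ≡-Reasoning
      restored : s ≡ (t [ to ]≔ lookup s to) [ from ]≔ (disk ∷ lookup t from)
      -- The two updates at `to` merge; commuting brings the two updates at `from` together, and
      -- they merge as well. What remains writes back the old stacks.
      restored = sym (begin
        (t [ to ]≔ lookup s to) [ from ]≔ (disk ∷ lookup t from)
          ≡⟨ cong ((t [ to ]≔ lookup s to) [ from ]≔_) (trans (cong (disk ∷_) lookup-from) (sym top)) ⟩
        (t [ to ]≔ lookup s to) [ from ]≔ lookup s from
          ≡⟨ cong (λ u → (u [ to ]≔ lookup s to) [ from ]≔ lookup s from) result ⟩
        (((s [ from ]≔ rest) [ to ]≔ _) [ to ]≔ lookup s to) [ from ]≔ lookup s from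
          ≡⟨ cong (_[ from ]≔ lookup s from) ([]≔-idempotent (s [ from ]≔ rest) to) ⟩
        ((s [ from ]≔ rest) [ to ]≔ lookup s to) [ from ]≔ lookup s from
          ≡⟨ []≔-commutes (s [ from ]≔ rest) to from (from≢to ∘ sym) ⟩
        ((s [ from ]≔ rest) [ from ]≔ lookup s from) [ to ]≔ lookup s to
          ≡⟨ cong (_[ to ]≔ lookup s to) ([]≔-idempotent s from) ⟩
        (s [ from ]≔ lookup s from) [ to ]≔ lookup s to
          ≡⟨ cong (_[ to ]≔ lookup s to) ([]≔-lookup s from) ⟩
        s [ to ]≔ lookup s to
          ≡⟨ []≔-lookup s to ⟩
        s ∎)

    -- The rules compare disks and never refer to the names of the pegs.
    permute-move : ∀ π → Move (permute π s) (permute π t)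
    permute-move π = record
      { from     = π ⟨$⟩ʳ from
      ; to       = π ⟨$⟩ʳ to
      ; disk     = disk
      ; rest     = rest
      ; from≢to  = λ eq → from≢to (trans (sym (inverseˡ π)) (trans (cong (π ⟨$⟩ˡ_) eq) (inverseˡ π)))
      ; top      = trans (lookup-permute π s from) top
      ; canPlace = subst (CanPlace disk) (sym (lookup-permute π s to)) canPlace
      ; result   = begin
          permute π t
            ≡⟨ cong (permute π) result ⟩
          permute π ((s [ from ]≔ rest) [ to ]≔ (disk ∷ lookup s to))
            ≡⟨ permute-update π (s [ from ]≔ rest) to _ ⟩
          permute π (s [ from ]≔ rest) [ π ⟨$⟩ʳ to ]≔ (disk ∷ lookup s to)
            ≡⟨ cong₂ (λ u ds → u [ π ⟨$⟩ʳ to ]≔ (disk ∷ ds))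
                     (permute-update π s from rest) (sym (lookup-permute π s to)) ⟩
          (permute π s [ π ⟨$⟩ʳ from ]≔ rest) [ π ⟨$⟩ʳ to ]≔ (disk ∷ lookup (permute π s) (π ⟨$⟩ʳ to)) ∎
      }
      where open ≡-Reasoning

  -- Sequences of moves: concatenation, reversal and renaming of pegs.

  movedDisks-◅◅ : ∀ {s t u} (ms : Moves s t) (ms′ : Moves t u) →
    movedDisks (ms ◅◅ ms′) ≡ movedDisks ms ++ movedDisks ms′
  movedDisks-◅◅ ε        ms′ = refl
  movedDisks-◅◅ (m ◅ ms) ms′ = cong (Move.disk m ∷_) (movedDisks-◅◅ ms ms′)

  undoAll : ∀ {s t} → Legal s → Moves s t → Moves t s
  undoAll s-legal ε        = ε
  undoAll s-legal (m ◅ ms) = undoAll (move-legal m s-legal) ms ◅◅ undo m s-legal ◅ ε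

  movedDisks-undoAll : ∀ {s t} (s-legal : Legal s) (ms : Moves s t) →
    movedDisks (undoAll s-legal ms) ≡ reverse (movedDisks ms)
  movedDisks-undoAll s-legal ε        = refl
  movedDisks-undoAll s-legal (m ◅ ms) = begin
    movedDisks (undoAll _ ms ◅◅ undo m s-legal ◅ ε)
      ≡⟨ movedDisks-◅◅ (undoAll _ ms) _ ⟩
    movedDisks (undoAll _ ms) ∷ʳ Move.disk m
      ≡⟨ cong (_∷ʳ Move.disk m) (movedDisks-undoAll _ ms) ⟩
    reverse (movedDisks ms) ∷ʳ Move.disk m
      ≡⟨ unfold-reverse (Move.disk m) (movedDisks ms) ⟨
    reverse (movedDisks (m ◅ ms)) ∎
    where open ≡-Reasoning

  numMoves-undoAll : ∀ {s t} (s-legal : Legal s) (ms : Moves s t) →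
    numMoves (undoAll s-legal ms) ≡ numMoves ms
  numMoves-undoAll s-legal ms =
    trans (cong length (movedDisks-undoAll s-legal ms)) (length-reverse (movedDisks ms))

  permute-moves : ∀ π {s t} → Moves s t → Moves (permute π s) (permute π t)
  permute-moves π = gmap (permute π) (λ m → permute-move m π)

  numMoves-permute : ∀ π {s t} (ms : Moves s t) → numMoves (permute-moves π ms) ≡ numMoves ms
  numMoves-permute π ε        = refl
  numMoves-permute π (m ◅ ms) = cong suc (numMoves-permute π ms)

  -- Where a disk can be before its first move.

  OnlyOn : Disk → Peg → State → Set
  OnlyOn b S s = ∀ q → b ∈ lookup s q → q ≡ S

  -- `OnlyOn` excludes the other pegs without asserting that `b` is on `S`. Hence a pop cannot break
  -- it, and a push could only do so with `b` itself.
  move-onlyOn : ∀ {b S s t} (m : Move s t) → Move.disk m ≢ b → OnlyOn b S s → OnlyOn b S t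
  move-onlyOn {b} {S} m disk≢b = move-preserves m (λ q ds → b ∈ ds → q ≡ S) (_∘ there)
    λ { only (here b≡disk) → contradiction (sym b≡disk) disk≢b
      ; only (there b∈ds)  → only b∈ds }

  tower-onlyOn : ∀ {b p} s → IsTower p s → OnlyOn b p s
  tower-onlyOn {p = p} s (_ , _ , s-empty) q b∈ with q ≟ p
  ... | yes q≡p = q≡p
  ... | no q≢p with () ← subst (_ ∈_) (s-empty q q≢p) b∈

  -- Moves of the biggest disk and the exchange of pegs.

  module _ {b : Disk} (biggest : IsBiggest b) where

    biggest-⊀ : ∀ {d} → ¬ (b ≺ d)
    biggest-⊀ {d} with d ≟ b
    ... | yes refl = ≺-irrefl
    ... | no d≢b   = asym (biggest d d≢b)

    module _ {s t : State} (s-legal : Legal s) (m : Move s t) where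
      open Move m

      -- In a legal state no disk lies under the biggest one, and it can only be placed on an empty
      -- peg. Both `rest` and the target stack are therefore empty, and the move swaps the two
      -- stacks.
      biggest-move : disk ≡ b → t ≡ permute (transpose from to) s
      biggest-move refl = begin
        t
          ≡⟨ result ⟩
        (s [ from ]≔ rest) [ to ]≔ (disk ∷ lookup s to)
          ≡⟨ cong₂ (λ x y → (s [ from ]≔ x) [ to ]≔ y)
                   (trans rest-empty (sym to-empty))
                   (trans (cong (disk ∷_) (trans to-empty (sym rest-empty))) (sym top)) ⟩
        (s [ from ]≔ lookup s to) [ to ]≔ lookup s from
          ≡⟨ permute-transpose from to s ⟨
        permute (transpose from to) s ∎
        where
        open ≡-Reasoning
        below-biggest : ∀ {ds} → Linked _≺_ (b ∷ ds) → ds ≡ []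
        below-biggest [-]       = refl
        below-biggest (b≺e ∷ _) = contradiction b≺e biggest-⊀
        under-biggest : ∀ {ds} → CanPlace b ds → ds ≡ []
        under-biggest on-empty        = refl
        under-biggest (on-larger b≺e) = contradiction b≺e biggest-⊀
        rest-empty = below-biggest (subst (Linked _≺_) top (s-legal from))
        to-empty   = under-biggest canPlace

    -- Induction on the moves before the first move of `b`, where `q` is the target of that first
    -- move. The first move of `b` is the exchange itself; each earlier move `m` is put in front of
    -- the detour obtained from its end state, and its undoing, with `S` and `q` exchanged, is put
    -- behind.
    detour : ∀ {S s t} → Legal s → OnlyOn b S s → (ms : Moves s t) → b ∈ movedDisks ms →
      ∃ λ q → q ≢ S × Σ (Moves s (permute (transpose S q) s)) λ ms′ →
        numMoves ms′ ≡ movesBeforeFirst b ms + suc (movesBeforeFirst b ms)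
    detour s-legal only (m ◅ ms) b∈ with Move.disk m ≟ b
    -- As `b` is on no peg but `S`, this move starts from `S`. Nothing precedes it, so the count is
    -- 0 + 1.
    ... | yes disk≡b with refl ← only (Move.from m)
                            (subst (b ∈_) (sym (Move.top m)) (here (sym disk≡b))) =
      Move.to m , Move.from≢to m ∘ sym ,
      subst (λ u → Σ (Moves _ u) λ ms′ → numMoves ms′ ≡ 1) (biggest-move s-legal m disk≡b) (m ◅ ε , refl)
    detour s-legal only (m ◅ ms) (here b≡disk) | no disk≢b = contradiction (sym b≡disk) disk≢b
    detour {S} {s} s-legal only (_◅_ {j = u} m ms) (there b∈) | no disk≢b
      with detour (move-legal m s-legal) (move-onlyOn m disk≢b only) ms b∈
    -- `m` and `back` add two moves, while the number of moves before the first move of `b` grows by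
    -- one.
    ... | q , q≢S , ms′ , eq = q , q≢S , m ◅ ms′ ◅◅ back ◅ ε , cong suc (begin
        length (movedDisks (ms′ ◅◅ back ◅ ε))
          ≡⟨ cong length (movedDisks-◅◅ ms′ (back ◅ ε)) ⟩
        length (movedDisks ms′ ∷ʳ Move.disk m)
          ≡⟨ length-++ (movedDisks ms′) ⟩
        numMoves ms′ + 1
          ≡⟨ +-comm (numMoves ms′) 1 ⟩
        suc (numMoves ms′)
          ≡⟨ cong suc eq ⟩
        suc (movesBeforeFirst b ms + suc (movesBeforeFirst b ms))
          ≡⟨ +-suc (movesBeforeFirst b ms) (suc (movesBeforeFirst b ms)) ⟨
        movesBeforeFirst b ms + suc (suc (movesBeforeFirst b ms)) ∎)
      where
      open ≡-Reasoning
      back : Move (permute (transpose S q) u) (permute (transpose S q) s)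
      back = permute-move (undo m s-legal) (transpose S q)

    -- Exchanging the pegs q and P redirects a transfer from S to q towards P,
    -- without affecting its initial state.
    short-transfer : ∀ {S P s t} → P ≢ S → IsTower S s → (ms : Moves s t) → b ∈ movedDisks ms →
      ∃ λ t′ → IsTower P t′ × Σ (Moves s t′) λ ms′ →
        numMoves ms′ ≡ movesBeforeFirst b ms + suc (movesBeforeFirst b ms)
    short-transfer {S} {P} {s} P≢S s-tower ms b∈
      with detour (tower-legal s s-tower) (tower-onlyOn s s-tower) ms b∈
    ... | q , q≢S , ms′ , eq =
      permute τ (permute σ s) ,
      subst (λ p → IsTower p (permute τ (permute σ s)))
            (trans (cong (τ ⟨$⟩ʳ_) (transpose-ˡ S q)) (transpose-ˡ q P))
            (permute-tower τ (permute σ s) (permute-tower σ s s-tower)) ,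
      subst (λ u → Σ (Moves u (permute τ (permute σ s))) λ ms″ →
                     numMoves ms″ ≡ movesBeforeFirst b ms + suc (movesBeforeFirst b ms))
            (permute-transpose-id q P s (trans (empty q q≢S) (sym (empty P P≢S))))
            (permute-moves τ ms′ , trans (numMoves-permute τ ms′) eq)
      where
      σ = transpose S q
      τ = transpose q P
      empty = proj₂ (proj₂ s-tower)

    after≤before : ∀ {S P s t} → P ≢ S → IsTower S s → (ms : Moves s t) → IsOptimal P ms →
      b ∈ movedDisks ms → movesAfterLast b ms ≤ movesBeforeFirst b ms
    after≤before P≢S s-tower ms optimal b∈ with short-transfer P≢S s-tower ms b∈
    -- Besides the common summand, each side carries a `suc`: on the left for a move of `b` in `ms`,
    -- on the right for the exchange in the middle of `ms′`.
    ... | t′ , t′-tower , ms′ , eq = s≤s⁻¹ (+-cancelˡ-≤ (movesBeforeFirst b ms) _ _ (begin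
      movesBeforeFirst b ms + suc (movesAfterLast b ms)   ≤⟨ prefixes-≤ b∈ ⟩
      numMoves ms                                         ≤⟨ optimal t′-tower ms′ ⟩
      numMoves ms′                                        ≡⟨ eq ⟩
      movesBeforeFirst b ms + suc (movesBeforeFirst b ms) ∎))
      where open ≤-Reasoning

  -- Reversing an optimal solution and comparing the two counts.

  undoAll-optimal : ∀ {S P s t} (s-tower : IsTower S s) → IsTower P t →
    (ms : Moves s t) → IsOptimal P ms → IsOptimal S (undoAll (tower-legal s s-tower) ms)
  undoAll-optimal {s = s} {t} s-tower t-tower ms optimal {s′} s′-tower ms′
    -- The competitor ends in some tower on `S`. It has to be `s` itself, so that the reversed
    -- competitor starts where `ms` does.
    with refl ← tower-unique s′ s s′-tower s-tower = begin
    numMoves (undoAll (tower-legal s s-tower) ms)  ≡⟨ numMoves-undoAll (tower-legal s s-tower) ms ⟩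
    numMoves ms                                  ≤⟨ optimal t-tower (undoAll t-legal ms′) ⟩
    numMoves (undoAll t-legal ms′)               ≡⟨ numMoves-undoAll t-legal ms′ ⟩
    numMoves ms′                                 ∎
    where
    open ≤-Reasoning
    t-legal = tower-legal t t-tower

  before≡after : ∀ {S P b s t} → P ≢ S → IsBiggest b → IsTower S s → IsTower P t →
    (ms : Moves s t) → IsOptimal P ms → movesBeforeFirst b ms ≡ movesAfterLast b ms
  before≡after {b = b} {s} P≢S biggest s-tower t-tower ms optimal with b ∈? movedDisks ms
  -- If `b` never moves, neither prefix is cut off, and both counts take their default value, the
  -- total number of moves.
  ... | no b∉ = begin
    length (prefixBefore b (movedDisks ms))
      ≡⟨ cong length (prefixBefore-∉ (movedDisks ms) b∉) ⟩
    length (movedDisks ms)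
      ≡⟨ length-reverse (movedDisks ms) ⟨
    length (reverse (movedDisks ms))
      ≡⟨ cong length (prefixBefore-∉ (reverse (movedDisks ms)) (b∉ ∘ reverse⁻)) ⟨
    length (prefixBefore b (reverse (movedDisks ms))) ∎
    where open ≡-Reasoning
  ... | yes b∈ = ≤-antisym before≤after (after≤before biggest P≢S s-tower ms optimal b∈)
    where
    s-legal = tower-legal s s-tower
    undone = movedDisks-undoAll s-legal ms
    before≤after : movesBeforeFirst b ms ≤ movesAfterLast b ms
    -- `after≤before` is applied to the reversed solution, a transfer from `P` to `S` in which the
    -- two counts have traded places; reversing twice recovers the original list.
    before≤after = begin
      length (prefixBefore b (movedDisks ms))
        ≡⟨ cong (length ∘ prefixBefore b) (trans (cong reverse undone) (reverse-involutive (movedDisks ms))) ⟨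
      movesAfterLast b (undoAll s-legal ms)
        ≤⟨ after≤before biggest (P≢S ∘ sym) t-tower (undoAll s-legal ms)
             (undoAll-optimal s-tower t-tower ms optimal)
             (subst (b ∈_) (sym undone) (reverse⁺ b∈)) ⟩
      movesBeforeFirst b (undoAll s-legal ms)
        ≡⟨ cong (length ∘ prefixBefore b) undone ⟩
      length (prefixBefore b (reverse (movedDisks ms))) ∎
      where open ≤-Reasoning

mainTheorem2 : ∀ {c ℓ₁ ℓ₂} (O : StrictTotalOrder c ℓ₁ ℓ₂) (k n : ℕ) → 3 ≤ k → 1 ≤ n →
    (size : Fin n → StrictTotalOrder.Carrier O) →
    Injective _≡_ (StrictTotalOrder._≈_ O) size →
    let open Hanoi O k n size in
    (Source P : Peg) → P ≢ Source →
    (biggest : Disk) → IsBiggest biggest →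
    (s t : State) → IsTower Source s → IsTower P t →
    (ms : Moves s t) → IsOptimal P ms →
    movesBeforeFirst biggest ms ≡ movesAfterLast biggest ms
mainTheorem2 O k n _ _ size _ _ _ P≢Source _ biggest _ _ s-tower t-tower =
  before≡after O k n size P≢Source biggest s-tower t-tower
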